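{- Let $p$ be a prime and let $k$ be a positive integer with $k \mid p-1$. The value of the least $k$-th power non-residue in an arithmetic progression $\{bn+c\}_{n=0,1,\ldots}$ over $\mathbb{F}_p$ is bounded by $$\frac{7}{\sqrt{5}} \cdot b \cdot \sqrt{\frac{p-1}{k}} + 4b + c .$$
   Context: $\mathbb{F}_p$ is the prime field with $p$ elements. An element $a \in \mathbb{F}_p$ is called a $k$-th power non-residue if there is no $y \in \mathbb{F}_p$ such that $y^k = a$. The terms $bn+c$ of the arithmetic progression are regarded as elements of $\mathbb{F}_p$ when asking whether they are $k$-th power non-residues. -}

module Defs where

open import Algebra.Bundles using (RawSemiring)
import Algebra.Definitions.RawSemiring as RawSemiringDefinitions
open import Data.Fin.Base using (Fin; toℕ)
import Data.Integer.Base as ℤ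
open ℤ using (ℤ; +_)
import Data.Nat.Base as ℕ
open ℕ using (ℕ; NonZero)
open import Data.Nat.DivMod using (_mod_)
open import Data.Product.Base using (_×_; ∃-syntax)
import Data.Rational.Base as ℚ
open ℚ using (ℚ; 0ℚ; 1ℚ)
open import Data.Sum.Base using (_⊎_)
open import Level using (0ℓ)
open import Relation.Binary.PropositionalEquality.Core using (_≡_)
open import Relation.Nullary.Negation.Core using (¬_)

-- For prime p this is the prime field 𝔽_p, with Fin p as carrier.
𝔽 : (p : ℕ) .{{_ : NonZero p}} → RawSemiring 0ℓ 0ℓ
𝔽 p = record
  { Carrier = Fin p
  ; _≈_     = _≡_
  ; _+_     = λ x y → (toℕ x ℕ.+ toℕ y) mod p
  ; _*_     = λ x y → (toℕ x ℕ.* toℕ y) mod p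
  ; 0#      = 0 mod p
  ; 1#      = 1 mod p
  }

-- The canonical map ℤ → 𝔽_p; _%ℕ_ is the remainder in [0, p), also for
-- negative integers.
[_]mod_ : ℤ → (p : ℕ) .{{_ : NonZero p}} → Fin p
[ z ]mod p = (z ℤ.%ℕ p) mod p

IsPowerNonResidue : (p : ℕ) .{{_ : NonZero p}} (k : ℕ) → Fin p → Set
IsPowerNonResidue p k a = ¬ (∃[ y ] y ^ k ≡ a)
  where open RawSemiringDefinitions (𝔽 p) using (_^_)

term : (b : ℕ) (c : ℤ) → ℕ → ℤ
term b c n = + b ℤ.* + n ℤ.+ c

NonResidueTerm : (p : ℕ) .{{_ : NonZero p}} (k b : ℕ) (c : ℤ) → ℤ → Set
NonResidueTerm p k b c v =
  (∃[ n ] v ≡ term b c n) × IsPowerNonResidue p k ([ v ]mod p)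

IsLeast : (ℤ → Set) → ℤ → Set
IsLeast P v = P v × (∀ w → P w → v ℤ.≤ w)

-- A real number x given by its Dedekind cut: lower q means q < x and
-- upper q means x < q.  The cut axioms are not part of the record; the
-- operations below are the usual ones on Dedekind cuts and preserve them
-- (_⁻¹ for x > 0, √ for x ≥ 0).
record ℝ : Set₁ where
  field
    lower : ℚ → Set
    upper : ℚ → Set

open ℝ

infixl 6 _+_
infixl 7 _*_ _÷_
infix  8 _⁻¹ √_
infix  4 _≤_

fromℚ : ℚ → ℝ
fromℚ r .lower q = q ℚ.< r
fromℚ r .upper q = r ℚ.< q

fromℤ : ℤ → ℝ
fromℤ z = fromℚ (z ℚ./ 1)

fromℕ : ℕ → ℝ
fromℕ n = fromℤ (+ n)

_+_ : ℝ → ℝ → ℝ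
(x + y) .lower q = ∃[ s ] ∃[ t ] lower x s × lower y t × q ≡ s ℚ.+ t
(x + y) .upper q = ∃[ s ] ∃[ t ] upper x s × upper y t × q ≡ s ℚ.+ t

-- Interval multiplication: x * y lies between the least and the greatest
-- of the four endpoint products whenever s < x < s′ and t < y < t′.
_*_ : ℝ → ℝ → ℝ
(x * y) .lower q = ∃[ s ] ∃[ s′ ] ∃[ t ] ∃[ t′ ]
  lower x s × upper x s′ × lower y t × upper y t′ ×
  q ℚ.< (s ℚ.* t) ℚ.⊓ (s ℚ.* t′) ℚ.⊓ (s′ ℚ.* t) ℚ.⊓ (s′ ℚ.* t′)
(x * y) .upper q = ∃[ s ] ∃[ s′ ] ∃[ t ] ∃[ t′ ]
  lower x s × upper x s′ × lower y t × upper y t′ ×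
  (s ℚ.* t) ℚ.⊔ (s ℚ.* t′) ℚ.⊔ (s′ ℚ.* t) ℚ.⊔ (s′ ℚ.* t′) ℚ.< q

-- Meaningful for x > 0 only.
_⁻¹ : ℝ → ℝ
(x ⁻¹) .lower q = ∃[ r ] upper x r × q ℚ.* r ℚ.< 1ℚ
(x ⁻¹) .upper q = ∃[ r ] 0ℚ ℚ.< r × lower x r × 1ℚ ℚ.< q ℚ.* r

_÷_ : ℝ → ℝ → ℝ
x ÷ y = x * y ⁻¹

-- Meaningful for x ≥ 0 only.
√_ : ℝ → ℝ
(√ x) .lower q = q ℚ.< 0ℚ ⊎ lower x (q ℚ.* q)
(√ x) .upper q = 0ℚ ℚ.< q × upper x (q ℚ.* q)

-- For genuine cuts this agrees with inclusion of lower halves.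
_≤_ : ℝ → ℝ → Set
x ≤ y = ∀ q → upper y q → upper x q

{-# OPTIONS --safe #-}

-- Write N = (p - 1) / k and s = ⌊√N⌋.  If p ∤ b and the terms c + b i with
-- i < 2 s + 3 are all k-th powers, then x ^ (N + 1) = x in 𝔽_p at each of
-- them.  Following Stepanov (and Hanson–Petridis), take the (s + 1)-fold
-- difference with step b of x ^ (N + s).  Its degree is N - 1, and its
-- leading coefficient is a product of factors b t with t ≤ N + s < p, hence
-- nonzero.  At each of the s + 2 points c + b i, i ≤ s + 1, its derivatives
-- of order j < s are multiples of the (s + 1)-fold difference of
-- x ^ (s - j), which is zero.  So it has at least (s + 2) s ≥ N zeros
-- counted with multiplicity, a contradiction.  The least non-residue is
-- thus at most b (2 s + 2) + c.

module Submission where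

open import Data.Integer.Base as ℤ using (ℤ; +_)
import Data.Integer.Properties as ℤ
open import Data.Integer.Tactic.RingSolver using (solve-∀)
open import Data.Nat.Base as ℕ using (ℕ; zero; suc; NonZero; _∸_; z≤n; s≤s)
import Data.Nat.Properties as ℕ
open import Data.Nat.Primality using (Prime; euclidsLemma; prime⇒nonTrivial)
open import Data.Product.Base using (Σ-syntax; ∃-syntax; _×_; _,_)
open import Data.Sum.Base as Sum using (_⊎_; inj₁; inj₂; [_,_]′)
open import Function.Base using (_∘_; id)
open import Relation.Binary.PropositionalEquality
open import Relation.Nullary using (¬_; contradiction; yes; no)
open import Relation.Nullary.Decidable using (decidable-stable; from-yes)

-- Integer polynomials with their derivatives, and the effect of differencing on degree and leading
-- coefficient.

module Jets where

  open import Data.Integer.Base using (_+_; _*_; _-_; _^_; 0ℤ; 1ℤ)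

  -- F j x stands for the j-th derivative at x of a polynomial F 0 over ℤ.
  Jet : Set
  Jet = ℕ → ℤ → ℤ

  -- F = (x - b) Q + F(b), together with all its derivatives.
  record Division (F : Jet) (b : ℤ) (Q : Jet) : Set where
    field
      value : ∀ x → F 0 x ≡ (x - b) * Q 0 x + F 0 b
      deriv : ∀ j x → F (suc j) x ≡ (x - b) * Q (suc j) x + + suc j * Q j x

  open Division public

  -- F is a polynomial of degree at most d with x ^ d-coefficient a,
  -- described by repeated division by linear factors, which keep the
  -- leading coefficient.
  Deg : ℕ → ℤ → Jet → Set
  Deg zero    a F = (∀ x → F 0 x ≡ a) × (∀ j x → F (suc j) x ≡ 0ℤ)
  Deg (suc d) a F = ∀ b → Σ[ Q ∈ Jet ] Deg d a Q × Division F b Q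

  infixl 6 _⊞_
  infixr 7 _⊡_

  _⊞_ : Jet → Jet → Jet
  (F ⊞ G) j x = F j x + G j x

  _⊡_ : ℤ → Jet → Jet
  (c ⊡ F) j x = c * F j x

  -- Leibniz' rule for x F: the factor x contributes only itself and its first derivative 1.
  X· : Jet → Jet
  X· F zero    x = x * F 0 x
  X· F (suc j) x = x * F (suc j) x + + suc j * F j x

  translate : ℤ → Jet → Jet
  translate h F j x = F j (x + h)

  δ : ℤ → (ℤ → ℤ) → ℤ → ℤ
  δ h f x = f (x + h) - f x

  Δ : ℤ → Jet → Jet
  Δ h F j = δ h (F j)

  deg-cong : ∀ {F G} → (∀ j x → F j x ≡ G j x) → ∀ d {a} → Deg d a F → Deg d a G
  deg-cong F≗G zero    (c , z) = (λ x → trans (sym (F≗G 0 x)) (c x)) , (λ j x → trans (sym (F≗G (suc j) x)) (z j x))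
  deg-cong F≗G (suc d) D b with D b
  ... | Q , DQ , div = Q , DQ , record
    { value = λ x → trans (sym (F≗G 0 x)) (trans (value div x) (cong (λ c → (x - b) * Q 0 x + c) (F≗G 0 b)))
    ; deriv = λ j x → trans (sym (F≗G (suc j) x)) (deriv div j x)
    }

  deg-⊞ : ∀ d {a a′ F G} → Deg d a F → Deg d a′ G → Deg d (a + a′) (F ⊞ G)
  deg-⊞ zero    (c , z) (c′ , z′) =
    (λ x → cong₂ _+_ (c x) (c′ x)) , (λ j x → cong₂ _+_ (z j x) (z′ j x))
  deg-⊞ (suc d) D D′ b with D b | D′ b
  ... | Q , DQ , div | Q′ , DQ′ , div′ = Q ⊞ Q′ , deg-⊞ d DQ DQ′ , record
    { value = λ x → trans (cong₂ _+_ (value div x) (value div′ x)) (regroup (x - b) _ _ _ _)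
    ; deriv = λ j x → trans (cong₂ _+_ (deriv div j x) (deriv div′ j x)) (regroup′ (x - b) _ (+ suc j) _ _ _)
    }
    where
    regroup : ∀ y q c q′ c′ → (y * q + c) + (y * q′ + c′) ≡ y * (q + q′) + (c + c′)
    regroup = solve-∀
    regroup′ : ∀ y q n r q′ r′ → (y * q + n * r) + (y * q′ + n * r′) ≡ y * (q + q′) + n * (r + r′)
    regroup′ = solve-∀

  deg-⊡ : ∀ c d {a F} → Deg d a F → Deg d (c * a) (c ⊡ F)
  deg-⊡ c zero    (v , z) = (λ x → cong (c *_) (v x)) , (λ j x → trans (cong (c *_) (z j x)) (ℤ.*-zeroʳ c))
  deg-⊡ c (suc d) D b with D b
  ... | Q , DQ , div = c ⊡ Q , deg-⊡ c d DQ , record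
    { value = λ x → trans (cong (c *_) (value div x)) (regroup c (x - b) _ _)
    ; deriv = λ j x → trans (cong (c *_) (deriv div j x)) (regroup′ c (x - b) _ (+ suc j) _)
    }
    where
    regroup : ∀ c y q e → c * (y * q + e) ≡ y * (c * q) + c * e
    regroup = solve-∀
    regroup′ : ∀ c y q n r → c * (y * q + n * r) ≡ y * (c * q) + n * (c * r)
    regroup′ = solve-∀

  -- The index of `Deg` is a formal degree, so the coefficient may vanish. This allows `deg-⊞` to
  -- add summands whose degrees differ by one.
  deg-raise : ∀ d {a F} → Deg d a F → Deg (suc d) 0ℤ F
  deg-raise zero {a} {F} (v , z) b = (λ _ _ → 0ℤ) , ((λ _ → refl) , (λ _ _ → refl)) , record
    { value = λ x → trans (trans (v x) (sym (v b))) (regroup (x - b) _)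
    ; deriv = λ j x → trans (z j x) (regroup′ (x - b) (+ suc j))
    }
    where
    regroup : ∀ y c → c ≡ y * 0ℤ + c
    regroup = solve-∀
    regroup′ : ∀ y n → 0ℤ ≡ y * 0ℤ + n * 0ℤ
    regroup′ = solve-∀
  deg-raise (suc d) D b with D b
  ... | Q , DQ , div = Q , deg-raise d DQ , div

  -- x f = (x - b) (f + b q) + b f(b) whenever f = (x - b) q + f(b).
  deg-X· : ∀ d {a F} → Deg d a F → Deg (suc d) a (X· F)
  deg-X· zero {a} {F} (v , z) b = F , (v , z) , record
    { value = λ x → trans (cong (x *_) (v x)) (trans (regroup x b a) (sym (cong₂ (λ s t → (x - b) * s + b * t) (v x) (v b))))
    ; deriv = λ j x → cong (λ t → t + + suc j * F j x) (trans (cong (x *_) (z j x)) (trans (regroup′ x b) (sym (cong ((x - b) *_) (z j x)))))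
    }
    where
    regroup : ∀ x b a → x * a ≡ (x - b) * a + b * a
    regroup = solve-∀
    regroup′ : ∀ x b → x * 0ℤ ≡ (x - b) * 0ℤ
    regroup′ = solve-∀
  deg-X· (suc d) {a} {F} D b with D b
  ... | Q , DQ , div = F ⊞ b ⊡ Q , lead , record
    { value = λ x → trans (regroup₁ x b (F 0 x))
        (trans (cong (λ t → (x - b) * F 0 x + b * t) (value div x)) (regroup₂ x b (F 0 x) _ _))
    ; deriv = λ j x → trans (regroup₃ x b (F (suc j) x) (+ suc j) (F j x))
        (trans (cong (λ t → (x - b) * F (suc j) x + b * t + + suc j * F j x) (deriv div j x))
          (regroup₄ x b (F (suc j) x) (+ suc j) (F j x) _ _))
    }
    where
    lead : Deg (suc d) a (F ⊞ b ⊡ Q)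
    lead = subst (λ a′ → Deg (suc d) a′ (F ⊞ b ⊡ Q)) (ℤ.+-identityʳ a)
      (deg-⊞ (suc d) {a} {0ℤ} {F} {b ⊡ Q} D (deg-raise d {F = b ⊡ Q} (deg-⊡ b d {F = Q} DQ)))
    regroup₁ : ∀ x b f → x * f ≡ (x - b) * f + b * f
    regroup₁ = solve-∀
    regroup₂ : ∀ x b f q c → (x - b) * f + b * ((x - b) * q + c) ≡ (x - b) * (f + b * q) + b * c
    regroup₂ = solve-∀
    regroup₃ : ∀ x b f n g → x * f + n * g ≡ (x - b) * f + b * f + n * g
    regroup₃ = solve-∀
    regroup₄ : ∀ x b f n g q r → (x - b) * f + b * ((x - b) * q + n * r) + n * g ≡ (x - b) * (f + b * q) + n * (g + b * r)
    regroup₄ = solve-∀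

  deg-translate : ∀ h d {a F} → Deg d a F → Deg d a (translate h F)
  deg-translate h zero    (v , z) = (λ x → v (x + h)) , (λ j x → z j (x + h))
  -- Division by x - (b + h), with x + h substituted for x, is division by x - b.
  deg-translate h (suc d) {F = F} D b with D (b + h)
  ... | Q , DQ , div = translate h Q , deg-translate h d DQ , record
    { value = λ x → trans (value div (x + h)) (cong (λ y → y * Q 0 (x + h) + F 0 (b + h)) (shift x b h))
    ; deriv = λ j x → trans (deriv div j (x + h)) (cong (λ y → y * Q (suc j) (x + h) + + suc j * Q j (x + h)) (shift x b h))
    }
    where
    shift : ∀ x b h → (x + h) - (b + h) ≡ x - b
    shift = solve-∀

  -- The product rule for differences: x - b has difference h, so (x - b) Q contributes (x - b) Δ Q
  -- + h Q(x + h), and the constant F(b) cancels.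
  Δ-division : ∀ h {F b Q} → Division F b Q →
    (∀ x → Δ h F 0 x ≡ (x - b) * Δ h Q 0 x + h * Q 0 (x + h)) ×
    (∀ j x → Δ h F (suc j) x ≡ (x - b) * Δ h Q (suc j) x + h * Q (suc j) (x + h) + + suc j * Δ h Q j x)
  Δ-division h {F} {b} {Q} div =
    (λ x → trans (cong₂ _-_ (value div (x + h)) (value div x)) (regroup x b h _ _ _)) ,
    (λ j x → trans (cong₂ _-_ (deriv div j (x + h)) (deriv div j x)) (regroup′ x b h (+ suc j) _ _ _ _))
    where
    regroup : ∀ x b h q₁ q c → ((x + h - b) * q₁ + c) - ((x - b) * q + c) ≡ (x - b) * (q₁ - q) + h * q₁
    regroup = solve-∀
    regroup′ : ∀ x b h n q₁ r₁ q r → ((x + h - b) * q₁ + n * r₁) - ((x - b) * q + n * r)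
      ≡ (x - b) * (q₁ - q) + h * q₁ + n * (r₁ - r)
    regroup′ = solve-∀

  -- In the product rule, Q(x + h) is divided by x - b once more, with quotient R, so Δ F has
  -- quotient Δ Q + h R. If F has degree n, the two leading coefficients h (n - 1) a and h a add up
  -- to h n a.
  deg-Δ : ∀ h d {a F} → Deg (suc d) a F → Deg d (h * + suc d * a) (Δ h F)
  deg-Δ h zero {a} {F} D with D 0ℤ
  ... | Q , (v , z) , div with Δ-division h div
  ... | Δv , Δd =
    (λ x → trans (Δv x) (trans (cong₂ (λ s t → (x - 0ℤ) * (s - t) + h * s) (v (x + h)) (v x)) (regroup x h a))) ,
    λ j x → trans (Δd j x) (trans (cong₂ (λ s t → (x - 0ℤ) * (s - t) + h * s + + suc j * Δ h Q j x) (z j (x + h)) (z j x))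
              (trans (cong (λ t → (x - 0ℤ) * (0ℤ - 0ℤ) + h * 0ℤ + + suc j * t) (const j x)) (regroup′ x h (+ suc j))))
    where
    const : ∀ j x → Δ h Q j x ≡ 0ℤ
    const zero    x = trans (cong₂ _-_ (v (x + h)) (v x)) (ℤ.+-inverseʳ a)
    const (suc j) x = cong₂ _-_ (z j (x + h)) (z j x)
    regroup : ∀ x h a → (x - 0ℤ) * (a - a) + h * a ≡ h * 1ℤ * a
    regroup = solve-∀
    regroup′ : ∀ x h n → (x - 0ℤ) * (0ℤ - 0ℤ) + h * 0ℤ + n * 0ℤ ≡ 0ℤ
    regroup′ = solve-∀
  deg-Δ h (suc d) {a} {F} D b with D b
  ... | Q , DQ , div with Δ-division h div | deg-translate h (suc d) {F = Q} DQ b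
  ... | Δv , Δd | R , DR , divR = Δ h Q ⊞ h ⊡ R , lead , record
    { value = λ x → trans (Δv x) (trans (cong (λ t → (x - b) * Δ h Q 0 x + h * t) (value divR x))
        (trans (regroup₁ (x - b) h _ _ _) (cong (λ c → (x - b) * (Δ h Q 0 x + h * R 0 x) + c) (sym at-b))))
    ; deriv = λ j x → trans (Δd j x) (trans (cong (λ t → (x - b) * Δ h Q (suc j) x + h * t + + suc j * Δ h Q j x) (deriv divR j x))
        (regroup₂ (x - b) h (+ suc j) _ _ _ _))
    }
    where
    at-b : Δ h F 0 b ≡ h * Q 0 (b + h)
    at-b = trans (Δv b) (regroup b h _ _)
      where
      regroup : ∀ b h q r → (b - b) * q + h * r ≡ h * r
      regroup = solve-∀
    lead : Deg d (h * + suc (suc d) * a) (Δ h Q ⊞ h ⊡ R)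
    lead = subst (λ a′ → Deg d a′ (Δ h Q ⊞ h ⊡ R)) (regroup h (+ suc d) a)
      (deg-⊞ d {F = Δ h Q} {G = h ⊡ R} (deg-Δ h d {F = Q} DQ) (deg-⊡ h d {F = R} DR))
      where
      regroup : ∀ h n a → h * n * a + h * a ≡ h * (1ℤ + n) * a
      regroup = solve-∀
    regroup₁ : ∀ y h q r c → y * q + h * (y * r + c) ≡ y * (q + h * r) + h * c
    regroup₁ = solve-∀
    regroup₂ : ∀ y h n q r s t → y * q + h * (y * r + n * s) + n * t ≡ y * (q + h * r) + n * (t + h * s)
    regroup₂ = solve-∀

  pow : ℕ → Jet
  pow M       zero    x = x ^ M
  pow zero    (suc j) x = 0ℤ
  pow (suc M) (suc j) x = + suc M * pow M j x

  -- Reconciles the power-rule recursion of `pow` with Leibniz' rule, so that `deg-X·` can build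
  -- powers one factor at a time.
  pow-suc : ∀ M j x → X· (pow M) j x ≡ pow (suc M) j x
  pow-suc M       zero          x = refl
  pow-suc zero    (suc zero)    x = regroup x
    where
    regroup : ∀ x → x * 0ℤ + 1ℤ * 1ℤ ≡ 1ℤ * 1ℤ
    regroup = solve-∀
  pow-suc zero    (suc (suc j)) x = regroup x (+ suc (suc j))
    where
    regroup : ∀ x n → x * 0ℤ + n * 0ℤ ≡ 1ℤ * 0ℤ
    regroup = solve-∀
  pow-suc (suc M) (suc zero)    x = regroup x (+ suc M) (x ^ M)
    where
    regroup : ∀ x n y → x * (n * y) + 1ℤ * (x * y) ≡ (1ℤ + n) * (x * y)
    regroup = solve-∀
  pow-suc (suc M) (suc (suc j)) x =
    trans (regroup₁ x (+ suc M) (+ suc j) _ _)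
      (trans (cong (λ t → + suc M * (t + pow M j x)) (pow-suc M (suc j) x)) (regroup₂ (+ suc M) _))
    where
    regroup₁ : ∀ x m n f g → x * (m * f) + (1ℤ + n) * (m * g) ≡ m * (x * f + n * g + g)
    regroup₁ = solve-∀
    regroup₂ : ∀ m g → m * (m * g + g) ≡ (1ℤ + m) * (m * g)
    regroup₂ = solve-∀

  deg-pow : ∀ M → Deg M 1ℤ (pow M)
  deg-pow zero    = (λ _ → refl) , (λ _ _ → refl)
  deg-pow (suc M) = deg-cong (pow-suc M) (suc M) (deg-X· M {F = pow M} (deg-pow M))

-- Zeros with multiplicity modulo a prime, Fermat's little theorem, and the Stepanov argument.

module ZerosModulo where

  open Jets
  open import Data.Integer.Base using (_+_; _*_; _-_; _^_; 0ℤ; 1ℤ)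
  open import Data.Integer.Divisibility.Signed
    using (_∣_; ∣ᵤ⇒∣; ∣⇒∣ᵤ; ∣-refl; ∣m∣n⇒∣m+n; ∣m∣n⇒∣m-n; ∣m+n∣n⇒∣m; ∣n⇒∣m*n; ∣m⇒∣m*n)
  open import Data.List.Base using ([]; _∷_; length; applyUpTo)
  open import Data.List.Properties using (length-applyUpTo)
  open import Data.List.Relation.Unary.All as All using (All; []; _∷_)
  import Data.List.Relation.Unary.All.Properties as All
  open import Data.List.Relation.Unary.AllPairs using (AllPairs; []; _∷_)
  import Data.List.Relation.Unary.AllPairs.Properties as AllPairs
  open import Data.Nat.Base using (_<_; _≤_)
  import Data.Nat.Divisibility as ℕ

  -- The innermost difference is taken first, so that `Δ^ h (suc r) F` is `Δ^ h r (Δ h F)` by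
  -- definition and inductions can replace F by its difference.
  δ^ : ℤ → ℕ → (ℤ → ℤ) → ℤ → ℤ
  δ^ h zero    f = f
  δ^ h (suc r) f = δ^ h r (δ h f)

  Δ^ : ℤ → ℕ → Jet → Jet
  Δ^ h r F j = δ^ h r (F j)

  δ^-cong : ∀ h r {f g} → (∀ x → f x ≡ g x) → ∀ x → δ^ h r f x ≡ δ^ h r g x
  δ^-cong h zero    f≗g x = f≗g x
  δ^-cong h (suc r) f≗g x = δ^-cong h r (λ y → cong₂ _-_ (f≗g (y + h)) (f≗g y)) x

  δ^-scale : ∀ h r c f x → δ^ h r (λ y → c * f y) x ≡ c * δ^ h r f x
  δ^-scale h zero    c f x = refl
  δ^-scale h (suc r) c f x = trans (δ^-cong h r (λ y → distrib c (f (y + h)) (f y)) x) (δ^-scale h r c (δ h f) x)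
    where
    distrib : ∀ c s t → c * s - c * t ≡ c * (s - t)
    distrib = solve-∀

  δ^-zero : ∀ h r {f} → (∀ x → f x ≡ 0ℤ) → ∀ x → δ^ h r f x ≡ 0ℤ
  δ^-zero h zero    f≗0 x = f≗0 x
  δ^-zero h (suc r) f≗0 x = δ^-zero h r (λ y → cong₂ _-_ (f≗0 (y + h)) (f≗0 y)) x

  -- Each difference lowers the degree by one, and the difference of a constant is zero.
  δ^-annihilates : ∀ h {d r a F} → d < r → Deg d a F → ∀ x → δ^ h r (F 0) x ≡ 0ℤ
  δ^-annihilates h {zero} {suc r} {a} (s≤s _) (v , _) =
    δ^-zero h r (λ y → trans (cong₂ _-_ (v (y + h)) (v y)) (ℤ.+-inverseʳ a))
  δ^-annihilates h {suc d} {suc r} {F = F} (s≤s d<r) D = δ^-annihilates h {F = Δ h F} d<r (deg-Δ h d {F = F} D)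

  -- Multiplicity is measured by plain derivatives, without division by j!. For m a prime p this is
  -- divisibility by (x - b) ^ e modulo p as long as e ≤ p, whence the bounds on e below.
  VanishesTo : ℤ → ℕ → Jet → ℤ → Set
  VanishesTo m e F b = ∀ j → j < e → m ∣ F j b

  module _ {m : ℤ} where

    -- An r-fold difference at x samples its function only at x, x + h, ..., x + r h.
    δ^-local : ∀ h r {f g} x → (∀ i → i ≤ r → m ∣ f (x + h * + i) - g (x + h * + i)) →
      m ∣ δ^ h r f x - δ^ h r g x
    δ^-local h zero {f} {g} x f≈g = subst (λ y → m ∣ f y - g y) (base x h) (f≈g 0 z≤n)
      where
      base : ∀ x h → x + h * 0ℤ ≡ x
      base = solve-∀
    δ^-local h (suc r) {f} {g} x f≈g = δ^-local h r x λ i i≤r →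
      subst (m ∣_) (swap (f (x + h * + i + h)) _ _ _)
        (∣m∣n⇒∣m-n (subst (λ y → m ∣ f y - g y) (next x h (+ i)) (f≈g (suc i) (s≤s i≤r))) (f≈g i (ℕ.m≤n⇒m≤1+n i≤r)))
      where
      swap : ∀ s t u v → (s - t) - (u - v) ≡ (s - u) - (t - v)
      swap = solve-∀
      next : ∀ x h i → x + h * (1ℤ + i) ≡ x + h * i + h
      next = solve-∀

    -- x ^ N acts as 1 on the progression, up to the zeros of x, so the
    -- j-th derivative of x ^ (e + N) is there a multiple of x ^ (e - j),
    -- which r-fold differencing kills.
    δ^-pow-zero : ∀ h N r x → (∀ i → i ≤ r → m ∣ (x + h * + i) ^ suc N - (x + h * + i)) →
      ∀ e → e < r → VanishesTo m e (Δ^ h r (pow (e ℕ.+ N))) x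
    δ^-pow-zero h N r x fix (suc e) e<r zero (s≤s _) =
      subst (m ∣_) (trans (cong (λ t → δ^ h r (λ y → y ^ (suc e ℕ.+ N)) x - t) (δ^-annihilates h e<r (deg-pow (suc e)) x)) (sub-zero _))
        (δ^-local h r x λ i i≤r → subst (m ∣_) (factor (x + h * + i)) (∣m⇒∣m*n ((x + h * + i) ^ e) (fix i i≤r)))
      where
      sub-zero : ∀ t → t - 0ℤ ≡ t
      sub-zero = solve-∀
      factor : ∀ z → (z ^ suc N - z) * z ^ e ≡ z ^ (suc e ℕ.+ N) - z ^ suc e
      factor z rewrite ℤ.^-distribˡ-+-* z e N = regroup z (z ^ N) (z ^ e)
        where
        regroup : ∀ z s t → (z * s - z) * t ≡ z * (t * s) - z * t
        regroup = solve-∀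
    δ^-pow-zero h N r x fix (suc e) e<r (suc j) (s≤s j<e) =
      subst (m ∣_) (sym (δ^-scale h r (+ (suc e ℕ.+ N)) (pow (e ℕ.+ N) j) x))
        (∣n⇒∣m*n (+ (suc e ℕ.+ N)) (δ^-pow-zero h N r x fix e (ℕ.<-trans (ℕ.n<1+n e) e<r) j j<e))

  module _ {p : ℕ} (p-prime : Prime p) where

    euclid : ∀ x y → + p ∣ x * y → + p ∣ x ⊎ + p ∣ y
    euclid x y p∣xy = Sum.map ∣ᵤ⇒∣ ∣ᵤ⇒∣
      (euclidsLemma ℤ.∣ x ∣ ℤ.∣ y ∣ p-prime (subst (p ℕ.∣_) (ℤ.abs-* x y) (∣⇒∣ᵤ p∣xy)))

    cancel : ∀ {x y} → ¬ + p ∣ x → + p ∣ x * y → + p ∣ y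
    cancel {x} {y} p∤x p∣xy = [ (λ p∣x → contradiction p∣x p∤x) , id ]′ (euclid x y p∣xy)

    small-∤ : ∀ {n} → suc n < p → ¬ + p ∣ + suc n
    small-∤ n<p p∣n = ℕ.<⇒≱ n<p (ℕ.∣⇒≤ (∣⇒∣ᵤ p∣n))

    1<p : 1 < p
    1<p = ℕ.nonTrivial⇒n>1 p {{prime⇒nonTrivial p-prime}}

    -- Each difference multiplies the leading coefficient by h and by the current degree. That
    -- degree is positive and below p, so the product stays nonzero modulo p.
    deg-Δ^ : ∀ {h} → ¬ + p ∣ h → ∀ r d {a F} → r ℕ.+ d < p → ¬ + p ∣ a → Deg (r ℕ.+ d) a F →
      ∃[ a′ ] ¬ + p ∣ a′ × Deg d a′ (Δ^ h r F)
    deg-Δ^ p∤h zero    d {a} _ p∤a D = a , p∤a , D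
    deg-Δ^ {h} p∤h (suc r) d {a} {F} r+d<p p∤a D =
      deg-Δ^ p∤h r d {F = Δ h F} (ℕ.<-trans (ℕ.n<1+n _) r+d<p)
        (λ p∣ → p∤a (cancel {+ suc (r ℕ.+ d)} {a} (small-∤ r+d<p)
          (cancel {h} p∤h (subst (+ p ∣_) (ℤ.*-assoc h _ a) p∣))))
        (deg-Δ h (r ℕ.+ d) {F = F} D)

    -- At x = b the identity `deriv` reduces to F⁽ʲ⁺¹⁾(b) = (j + 1) Q⁽ʲ⁾(b), and j + 1 < p is
    -- invertible.
    divide-zero : ∀ {F b Q} → Division F b Q → ∀ {e} → suc e ≤ p → VanishesTo (+ p) (suc e) F b → VanishesTo (+ p) e Q b
    divide-zero {F} {b} {Q} div e<p zero-b j j<e =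
      cancel (small-∤ (ℕ.<-≤-trans (s≤s j<e) e<p))
        (subst (+ p ∣_) (trans (deriv div j b) (regroup b _ _)) (zero-b (suc j) (s≤s j<e)))
      where
      regroup : ∀ b s t → (b - b) * s + t ≡ t
      regroup = solve-∀

    -- Induction on j: once Q⁽ʲ⁾(y) vanishes, `deriv` leaves (y - b) Q⁽ʲ⁺¹⁾(y), and y - b is
    -- invertible.
    divide-other : ∀ {F b Q} → Division F b Q → + p ∣ F 0 b → ∀ {y} → ¬ + p ∣ y - b →
      ∀ {e} → VanishesTo (+ p) e F y → VanishesTo (+ p) e Q y
    divide-other {F} {b} {Q} div p∣Fb {y} p∤y-b zero-y zero 0<e =
      cancel p∤y-b (∣m+n∣n⇒∣m (subst (+ p ∣_) (value div y) (zero-y 0 0<e)) p∣Fb)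
    divide-other {F} {b} {Q} div p∣Fb {y} p∤y-b zero-y (suc j) j<e =
      cancel p∤y-b (∣m+n∣n⇒∣m (subst (+ p ∣_) (deriv div j y) (zero-y (suc j) j<e))
        (∣n⇒∣m*n (+ suc j) (divide-other div p∣Fb p∤y-b zero-y j (ℕ.<-trans (ℕ.n<1+n j) j<e))))

    -- Divides by x - b a total of e times. The quotient keeps the leading coefficient and the
    -- multiplicities at all points incongruent to b.
    remove-zero : ∀ e d {a F b} → e ≤ p → ¬ + p ∣ a → Deg d a F → VanishesTo (+ p) e F b →
      ∃[ d′ ] Σ[ Q ∈ Jet ] e ℕ.+ d′ ≡ d × Deg d′ a Q ×
        (∀ {y} → ¬ + p ∣ y - b → ∀ {e′} → VanishesTo (+ p) e′ F y → VanishesTo (+ p) e′ Q y)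
    remove-zero zero    d       {F = F} e≤p p∤a D zero-b = d , F , refl , D , λ _ → id
    -- The degree cannot run out first: the remaining constant a would be zero modulo p.
    remove-zero (suc e) zero    e≤p p∤a (v , _) zero-b =
      contradiction (subst (+ p ∣_) (v _) (zero-b 0 (s≤s z≤n))) p∤a
    remove-zero (suc e) (suc d) {b = b} e<p p∤a D zero-b with D b
    ... | Q , DQ , div with remove-zero e d {F = Q} (ℕ.<⇒≤ e<p) p∤a DQ (divide-zero div e<p zero-b)
    ... | d′ , R , eq , DR , keep =
      d′ , R , cong suc eq , DR , λ p∤y-b → keep p∤y-b ∘ divide-other div (zero-b 0 (s≤s z≤n)) p∤y-b

    count-zeros : ∀ e d {a F} bs → e ≤ p → ¬ + p ∣ a → Deg d a F →
      AllPairs (λ b y → ¬ + p ∣ y - b) bs → All (VanishesTo (+ p) e F) bs → length bs ℕ.* e ≤ d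
    count-zeros e d []       e≤p p∤a D [] [] = z≤n
    count-zeros e d {F = F} (b ∷ bs) e≤p p∤a D (≉b ∷ ≉bs) (zero-b ∷ zero-bs) with remove-zero e d {F = F} e≤p p∤a D zero-b
    ... | d′ , Q , refl , DQ , keep = ℕ.+-monoʳ-≤ e (count-zeros e d′ {F = Q} bs e≤p p∤a DQ ≉bs
      (All.zipWith (λ (≉ , z) → keep ≉ z) (≉b , zero-bs)))

    -- Write F = x Q + F(0). Since (j + 1) Q⁽ʲ⁾(0) = F⁽ʲ⁺¹⁾(0) and j + 1 < p, the derivatives of Q
    -- at 0 vanish as well. By induction Q is constant modulo p, with value Q(0) ≡ 0.
    deg-constant : ∀ d {a F} → d < p → Deg d a F → (∀ j → suc j ≤ d → + p ∣ F (suc j) 0ℤ) → ∀ x → + p ∣ F 0 x - F 0 0ℤ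
    deg-constant zero {a} d<p (v , _) _ x = subst (+ p ∣_) (sym (trans (cong₂ _-_ (v x) (v 0ℤ)) (ℤ.+-inverseʳ a))) (∣n⇒∣m*n 0ℤ ∣-refl)
    deg-constant (suc d) {F = F} d<p D p∣F x with D 0ℤ
    ... | Q , DQ , div = subst (+ p ∣_) (sym (trans (cong (_- F 0 0ℤ) (value div x)) (regroup x (Q 0 x) (F 0 0ℤ))))
        (∣n⇒∣m*n x (subst (+ p ∣_) (add-back (Q 0 x) (Q 0 0ℤ))
          (∣m∣n⇒∣m+n (deg-constant d {F = Q} (ℕ.<-trans (ℕ.n<1+n d) d<p) DQ (λ j j<d → p∣Q (suc j) (s≤s j<d)) x) (p∣Q 0 (s≤s z≤n)))))
      where
      regroup : ∀ x q c → (x - 0ℤ) * q + c - c ≡ x * q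
      regroup = solve-∀
      add-back : ∀ s t → s - t + t ≡ s
      add-back = solve-∀
      drop : ∀ s t → (0ℤ - 0ℤ) * s + t ≡ t
      drop = solve-∀
      p∣Q : ∀ j → suc j ≤ suc d → + p ∣ Q j 0ℤ
      p∣Q j j≤d = cancel (small-∤ (ℕ.≤-<-trans j≤d d<p))
        (subst (+ p ∣_) (trans (deriv div j 0ℤ) (drop (Q (suc j) 0ℤ) _)) (p∣F j j≤d))

    -- All derivatives of (x + 1) ^ p - x ^ p are divisible by p, so this
    -- polynomial is constant modulo p.
    freshman : ∀ x → + p ∣ (x + 1ℤ) ^ p - x ^ p - 1ℤ
    freshman = go p refl
      where
      go : ∀ q → q ≡ p → ∀ x → + p ∣ (x + 1ℤ) ^ q - x ^ q - 1ℤ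
      go zero    refl x = contradiction 1<p λ ()
      go (suc q) refl x =
        subst (λ t → + p ∣ (x + 1ℤ) ^ suc q - x ^ suc q - t)
          (cong₂ _-_ (ℤ.^-zeroˡ (suc q)) (ℤ.*-zeroˡ (0ℤ ^ q)))
          (deg-constant q {F = Δ 1ℤ (pow (suc q))} (ℕ.n<1+n q) (deg-Δ 1ℤ q {F = pow (suc q)} (deg-pow (suc q)))
            (λ j _ → ∣m∣n⇒∣m-n (∣m⇒∣m*n (pow q j 1ℤ) ∣-refl) (∣m⇒∣m*n (pow q j 0ℤ) ∣-refl)) x)

    -- Induction on n through `freshman`. Natural bases suffice, as roots in 𝔽_p are represented by
    -- `toℕ`.
    fermat : ∀ n → + p ∣ (+ n) ^ p - + n
    fermat zero = go p 1<p
      where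
      go : ∀ q → 1 < q → + p ∣ 0ℤ ^ q - 0ℤ
      go (suc q) _ = subst (+ p ∣_) (cong (_- 0ℤ) (sym (ℤ.*-zeroˡ (0ℤ ^ q)))) (∣n⇒∣m*n 0ℤ ∣-refl)
    fermat (suc n) = subst (λ y → + p ∣ y ^ p - y) (ℤ.+-comm (+ n) 1ℤ)
      (subst (+ p ∣_) (regroup ((+ n + 1ℤ) ^ p) ((+ n) ^ p) (+ n)) (∣m∣n⇒∣m+n (freshman (+ n)) (fermat n)))
      where
      regroup : ∀ s t n → (s - t - 1ℤ) + (t - n) ≡ s - (n + 1ℤ)
      regroup = solve-∀

  module _ {p : ℕ} (p-prime : Prime p) {b : ℤ} (p∤b : ¬ + p ∣ b) (c : ℤ) where

    private
      point : ℕ → ℤ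
      point i = c + b * + i

    point-distinct : ∀ {i j} → i < j → j < p → ¬ + p ∣ point j - point i
    point-distinct {i} i<j j<p p∣ with ℕ.m≤n⇒∃[o]m+o≡n i<j
    ... | o , refl = small-∤ p-prime (ℕ.≤-<-trans (s≤s (ℕ.m≤n+m o i)) j<p)
        (cancel p-prime p∤b (subst (+ p ∣_) (sym (difference b c (+ i) (+ o))) p∣))
      where
      difference : ∀ b c i o → b * (1ℤ + o) ≡ (c + b * (1ℤ + i + o)) - (c + b * i)
      difference = solve-∀

    -- The difference at `point i` samples the indices i, ..., i + s + 1. With i ≤ s + 1 these reach
    -- 2 s + 2, which accounts for the 2 s + 3 terms.
    point-zero : ∀ N s → (∀ i → i < 3 ℕ.+ (s ℕ.+ s) → + p ∣ point i ^ suc N - point i) →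
      ∀ {i} → i < 2 ℕ.+ s → VanishesTo (+ p) s (Δ^ b (suc s) (pow (s ℕ.+ N))) (point i)
    point-zero N s fix {i} (s≤s i≤1+s) = δ^-pow-zero b N (suc s) (point i)
      (λ j j≤1+s → subst (λ z → + p ∣ z ^ suc N - z) (regroup b c (+ i) (+ j))
          (fix (i ℕ.+ j) (s≤s (ℕ.≤-trans (ℕ.+-mono-≤ i≤1+s j≤1+s) (ℕ.≤-reflexive (cong suc (ℕ.+-suc s s)))))))
      s (ℕ.n<1+n s)
      where
      regroup : ∀ b c i j → c + b * (i + j) ≡ c + b * i + b * j
      regroup = solve-∀

    -- With N = `suc d`, the power x ^ (s + N) has degree (s + 1) + d, so d is the degree left after
    -- s + 1 differences.
    progression-bound : ∀ d s → 1 ≤ s → s ℕ.* s ≤ suc d → suc d < suc s ℕ.* suc s → suc d ℕ.+ suc d < p →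
      ¬ (∀ i → i < 3 ℕ.+ (s ℕ.+ s) → + p ∣ point i ^ suc (suc d) - point i)
    progression-bound d s 1≤s s²≤N N<[1+s]² 2N<p fix = count
      (deg-Δ^ p-prime p∤b (suc s) d {F = pow (s ℕ.+ suc d)}
        -- The initial degree s + N is at most 2 N < p.
        (subst (_< p) (ℕ.+-suc s d) (ℕ.≤-<-trans (ℕ.+-monoˡ-≤ (suc d) s≤N) 2N<p))
        (small-∤ p-prime (1<p p-prime))
        (subst (λ M → Deg M 1ℤ (pow (s ℕ.+ suc d))) (ℕ.+-suc s d) (deg-pow (s ℕ.+ suc d))))
      where
      s≤N : s ≤ suc d
      s≤N = ℕ.≤-trans (ℕ.m≤m*n s s {{ℕ.>-nonZero 1≤s}}) s²≤N
      s+s<p : s ℕ.+ s < p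
      s+s<p = ℕ.≤-<-trans (ℕ.+-mono-≤ s≤N s≤N) 2N<p
      -- As s ≥ 1, s + 2 ≤ 2 s + 1 ≤ p, so the s + 2 points are distinct modulo p.
      2+s≤p : 2 ℕ.+ s ≤ p
      2+s≤p = ℕ.≤-trans (s≤s (ℕ.+-monoˡ-≤ s 1≤s)) s+s<p
      -- Turns the zero count (s + 2) s ≤ N - 1 into (s + 1)² ≤ N, against the choice of s.
      square : suc s ℕ.* suc s ≡ suc ((2 ℕ.+ s) ℕ.* s)
      square = cong (λ t → suc (s ℕ.+ t)) (ℕ.*-suc s s)
      count : ¬ (∃[ a ] ¬ + p ∣ a × Deg d a (Δ^ b (suc s) (pow (s ℕ.+ suc d))))
      count (a , p∤a , D) = ℕ.<⇒≱ N<[1+s]² (subst (_≤ suc d) (sym square) (s≤s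
        (subst (λ l → l ℕ.* s ≤ d) (length-applyUpTo point (2 ℕ.+ s))
          (count-zeros p-prime s d {F = Δ^ b (suc s) (pow (s ℕ.+ suc d))} (applyUpTo point (2 ℕ.+ s))
            (ℕ.≤-trans (ℕ.m≤n+m s 2) 2+s≤p) p∤a D
            (AllPairs.applyUpTo⁺₁ point (2 ℕ.+ s) (λ i<j j<2+s → point-distinct i<j (ℕ.<-≤-trans j<2+s 2+s≤p)))
            (All.applyUpTo⁺₁ point (2 ℕ.+ s) (point-zero (suc d) s fix))))))

-- From powers in 𝔽_p to integer congruences, and the integer bound on the least non-residue.

module Residues where

  open ZerosModulo using (1<p; fermat; progression-bound)
  open import Defs using (𝔽; [_]mod_; IsPowerNonResidue; NonResidueTerm; IsLeast; term)
  import Algebra.Definitions.RawSemiring as RawSemiringDefinitions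
  open import Data.Fin.Base using (toℕ)
  open import Data.Fin.Properties using (toℕ-fromℕ<; toℕ<n; toℕ-injective)
  open import Data.Integer.Base using (_+_; _*_; _-_; _^_; 0ℤ; _%ℕ_; _/ℕ_)
  open import Data.Integer.DivMod using (a≡a%ℕn+[a/ℕn]*n; n%ℕd<d)
  open import Data.Integer.Divisibility.Signed
    using (_∣_; _∣?_; divides; ∣⇒∣ᵤ; ∣-refl; ∣m∣n⇒∣m+n; ∣m∣n⇒∣m-n; ∣n⇒∣m*n; ∣m⇒∣m*n)
  open import Data.Nat.Base using (_<_; _≤_; _%_)
  import Data.Nat.Divisibility as ℕ
  open import Data.Nat.DivMod as ℕ using (_mod_)

  toℕ-mod : ∀ m n .{{_ : NonZero n}} → toℕ (m mod n) ≡ m % n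
  toℕ-mod m n = toℕ-fromℕ< (ℕ.m%n<n m n)

  ∣^-^ : ∀ {m x y} n → m ∣ x - y → m ∣ x ^ n - y ^ n
  ∣^-^ zero m∣x-y = ∣n⇒∣m*n 0ℤ ∣-refl
  ∣^-^ {m} {x} {y} (suc n) m∣x-y = subst (m ∣_) (regroup x y (x ^ n) (y ^ n))
    (∣m∣n⇒∣m+n (∣n⇒∣m*n x (∣^-^ {m} {x} {y} n m∣x-y)) (∣m⇒∣m*n (y ^ n) m∣x-y))
    where
    regroup : ∀ x y s t → x * (s - t) + (x - y) * t ≡ x * s - y * t
    regroup = solve-∀

  module _ (p : ℕ) .{{_ : NonZero p}} where

    open RawSemiringDefinitions (𝔽 p) using () renaming (_^_ to _^ₚ_)

    toℕ-^ : ∀ y k → toℕ (y ^ₚ k) ≡ (toℕ y ℕ.^ k) % p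
    toℕ-^ y zero    = toℕ-mod 1 p
    toℕ-^ y (suc k) = begin
      toℕ (y ^ₚ suc k)                                ≡⟨ toℕ-mod (toℕ y ℕ.* toℕ (y ^ₚ k)) p ⟩
      (toℕ y ℕ.* toℕ (y ^ₚ k)) % p                    ≡⟨ cong (λ t → (toℕ y ℕ.* t) % p) (toℕ-^ y k) ⟩
      (toℕ y ℕ.* (toℕ y ℕ.^ k % p)) % p               ≡⟨ ℕ.%-distribˡ-* (toℕ y) (toℕ y ℕ.^ k % p) p ⟩
      ((toℕ y % p) ℕ.* (toℕ y ℕ.^ k % p % p)) % p     ≡⟨ cong (λ t → ((toℕ y % p) ℕ.* t) % p) (ℕ.m%n%n≡m%n (toℕ y ℕ.^ k) p) ⟩
      ((toℕ y % p) ℕ.* (toℕ y ℕ.^ k % p)) % p         ≡⟨ ℕ.%-distribˡ-* (toℕ y) (toℕ y ℕ.^ k) p ⟨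
      (toℕ y ℕ.* toℕ y ℕ.^ k) % p                     ∎
      where open ≡-Reasoning

    toℕ-[]mod : ∀ v → toℕ ([ v ]mod p) ≡ v %ℕ p
    toℕ-[]mod v = trans (toℕ-mod (v %ℕ p) p) (ℕ.m<n⇒m%n≡m (n%ℕd<d v p))

    ∣-%ℕ : ∀ v → + p ∣ v - + (v %ℕ p)
    ∣-%ℕ v = divides (v /ℕ p) (trans (cong (_- + (v %ℕ p)) (a≡a%ℕn+[a/ℕn]*n v p)) (regroup (+ (v %ℕ p)) (v /ℕ p * + p)))
      where
      regroup : ∀ r s → r + s - r ≡ s
      regroup = solve-∀

    <∧∣-⇒≡ : ∀ {m n} → m < p → n < p → + p ∣ + m - + n → m ≡ n
    <∧∣-⇒≡ {m} {n} m<p n<p p∣m-n with ℤ.∣ + m - + n ∣ in eq | ∣⇒∣ᵤ p∣m-n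
    ... | zero  | _   = ℤ.+-injective (ℤ.i-j≡0⇒i≡j (+ m) (+ n) (ℤ.∣i∣≡0⇒i≡0 eq))
    ... | suc t | p∣t = contradiction (ℕ.∣⇒≤ p∣t) (ℕ.<⇒≱ (subst (_< p) eq
      (subst (λ z → ℤ.∣ z ∣ < p) (sym (ℤ.m-n≡m⊖n m n)) (ℕ.≤-<-trans (ℤ.∣m⊝n∣≤m⊔n m n) (ℕ.⊔-pres-<m m<p n<p)))))

    []mod-cong : ∀ {v w} → + p ∣ v - w → [ v ]mod p ≡ [ w ]mod p
    []mod-cong {v} {w} p∣v-w = cong (_mod p) (<∧∣-⇒≡ (n%ℕd<d v p) (n%ℕd<d w p)
      (subst (+ p ∣_) (regroup v w (+ (v %ℕ p)) (+ (w %ℕ p)))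
        (∣m∣n⇒∣m+n (∣m∣n⇒∣m-n p∣v-w (∣-%ℕ v)) (∣-%ℕ w))))
      where
      regroup : ∀ v w r s → (v - w - (v - r)) + (w - s) ≡ r - s
      regroup = solve-∀

    residue-∣ : ∀ {k v} → ∃[ y ] y ^ₚ k ≡ [ v ]mod p → ∃[ n ] + p ∣ v - (+ n) ^ k
    residue-∣ {k} {v} (y , y^k≡v) = toℕ y , subst (+ p ∣_) (regroup v (+ (v %ℕ p)) ((+ toℕ y) ^ k))
      (∣m∣n⇒∣m-n (∣-%ℕ v) (subst (λ t → + p ∣ (+ toℕ y) ^ k - + t) eq
        (subst (λ t → + p ∣ t - + (toℕ y ℕ.^ k % p)) (pos-^ (toℕ y) k) (∣-%ℕ (+ (toℕ y ℕ.^ k))))))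
      where
      regroup : ∀ v r t → (v - r) - (t - r) ≡ v - t
      regroup = solve-∀
      eq : toℕ y ℕ.^ k % p ≡ v %ℕ p
      eq = trans (sym (toℕ-^ y k)) (trans (cong toℕ y^k≡v) (toℕ-[]mod v))
      pos-^ : ∀ m k → + (m ℕ.^ k) ≡ (+ m) ^ k
      pos-^ m zero    = refl
      pos-^ m (suc k) = trans (ℤ.pos-* m (m ℕ.^ k)) (cong (+ m *_) (pos-^ m k))

    -- Disposes of k = 1, where N = p - 1 is too large for 2 N < p.
    ¬first-power-nonresidue : ∀ a → ¬ IsPowerNonResidue p 1 a
    ¬first-power-nonresidue a nonres = nonres (a , toℕ-injective (begin
      toℕ (a ^ₚ 1)       ≡⟨ toℕ-^ a 1 ⟩
      (toℕ a ℕ.^ 1) % p  ≡⟨ cong (_% p) (ℕ.^-identityʳ (toℕ a)) ⟩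
      toℕ a % p          ≡⟨ ℕ.m<n⇒m%n≡m (toℕ<n a) ⟩
      toℕ a              ∎))
      where open ≡-Reasoning

    -- If v ≡ n ^ k, then v ^ (N + 1) ≡ n ^ (p + k - 1) = n ^ p n ^ (k - 1) ≡ n ^ k by `fermat`.
    -- Nothing is divided by n, so v ≡ 0 is covered.
    residue-fixed : Prime p → ∀ {k N v} .{{_ : NonZero k}} → p ≡ suc (N ℕ.* k) →
      ∃[ y ] y ^ₚ k ≡ [ v ]mod p → + p ∣ v ^ suc N - v
    residue-fixed p-prime {suc k} {N} {v} p≡ res with residue-∣ {suc k} {v} res
    ... | n , p∣v-y = subst (+ p ∣_) (regroup (v ^ suc N) v (y ^ suc N) y)
      (∣m∣n⇒∣m-n (∣m∣n⇒∣m+n (∣^-^ {x = v} {y} (suc N) p∣v-y) p∣y) p∣v-y)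
      where
      y = (+ n) ^ suc k
      regroup : ∀ s v t y → (s - t) + (t - y) - (v - y) ≡ s - v
      regroup = solve-∀
      factor : ∀ s n t → (s - n) * t ≡ s * t - n * t
      factor = solve-∀
      -- After the match, `k` is one less than the exponent of the power.
      exponent : p ℕ.+ k ≡ suc k ℕ.* suc N
      exponent = begin
        p ℕ.+ k                      ≡⟨ cong (ℕ._+ k) p≡ ⟩
        suc (N ℕ.* suc k ℕ.+ k)      ≡⟨ cong suc (ℕ.+-comm (N ℕ.* suc k) k) ⟩
        suc N ℕ.* suc k              ≡⟨ ℕ.*-comm (suc N) (suc k) ⟩
        suc k ℕ.* suc N              ∎
        where open ≡-Reasoning
      power : (+ n) ^ p * (+ n) ^ k ≡ y ^ suc N
      power = trans (sym (ℤ.^-distribˡ-+-* (+ n) p k)) (trans (cong ((+ n) ^_) exponent) (sym (ℤ.^-*-assoc (+ n) (suc k) (suc N))))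
      p∣y : + p ∣ y ^ suc N - y
      p∣y = subst (+ p ∣_) (trans (factor ((+ n) ^ p) (+ n) ((+ n) ^ k)) (cong (_- y) power))
        (∣m⇒∣m*n ((+ n) ^ k) (fermat p-prime n))

  floor-√ : ∀ n → ∃[ s ] s ℕ.* s ≤ n × n < suc s ℕ.* suc s
  floor-√ zero = 0 , z≤n , s≤s z≤n
  floor-√ (suc n) with floor-√ n
  ... | s , s²≤n , n<s′² with suc n ℕ.<? suc s ℕ.* suc s
  ... | yes sn<s′² = s , ℕ.m≤n⇒m≤1+n s²≤n , sn<s′²
  ... | no  sn≮s′² = suc s , ℕ.≮⇒≥ sn≮s′² , ℕ.≤-<-trans n<s′² (ℕ.*-mono-< (ℕ.n<1+n (suc s)) (ℕ.n<1+n (suc s)))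

  term-mono : ∀ b c {m n} → m ≤ n → term b c m ℤ.≤ term b c n
  term-mono b c m≤n = ℤ.+-monoˡ-≤ c (ℤ.*-monoˡ-≤-nonNeg (+ b) (ℤ.+≤+ m≤n))

  least-nonresidue-≤ : ∀ p .{{_ : NonZero p}} → Prime p → ∀ k N .{{_ : NonZero k}} → p ≡ suc (N ℕ.* k) →
    ∀ s → s ℕ.* s ≤ N → N < suc s ℕ.* suc s →
    ∀ b c v → IsLeast (NonResidueTerm p k b c) v → v ℤ.≤ term b c (2 ℕ.+ (s ℕ.+ s))
  least-nonresidue-≤ p p-prime (suc zero) N p≡ s s²≤N N<s′² b c v ((_ , nonres) , _) =
    contradiction nonres (¬first-power-nonresidue p _)
  least-nonresidue-≤ p p-prime (suc (suc k)) zero    p≡ s s²≤N N<s′² b c v _ =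
    contradiction p≡ (λ p≡1 → ℕ.<⇒≢ (1<p p-prime) (sym p≡1))
  least-nonresidue-≤ p p-prime k@(suc (suc _)) (suc d) p≡ zero s²≤N N<s′² b c v _ = contradiction N<s′² λ { (s≤s ()) }
  least-nonresidue-≤ p p-prime k@(suc (suc k-2)) N@(suc d) p≡ s@(suc _) s²≤N N<s′² b c v (((n , v≡) , nonres) , least)
    with + p ∣? + b
  -- All terms are congruent to c, so the initial term is itself a non-residue.
  ... | yes p∣b = ℤ.≤-trans (least (term b c 0) ((0 , refl) , subst (IsPowerNonResidue p k) v≡c nonres))
                    (term-mono b c z≤n)
    where
    regroup : ∀ b n c → b * n ≡ (b * n + c) - (b * 0ℤ + c)
    regroup = solve-∀
    v≡c : [ v ]mod p ≡ [ term b c 0 ]mod p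
    v≡c = []mod-cong p {v} {term b c 0} (subst (λ t → + p ∣ t - term b c 0) (sym v≡)
      (subst (+ p ∣_) (regroup (+ b) (+ n) c) (∣m⇒∣m*n (+ n) p∣b)))
  -- If v exceeded the bound, the first 2 s + 3 terms would all lie below v. Minimality gives only
  -- that such a term is not a non-residue; decidability of the divisibility removes the double
  -- negation.
  ... | no p∤b = ℤ.≮⇒≥ λ bound<v → progression-bound p-prime p∤b c d s (s≤s z≤n) s²≤N N<s′² 2N<p λ i i<3+2s →
      decidable-stable (+ p ∣? _) λ p∤ →
        ℤ.<⇒≱ (ℤ.≤-<-trans (term-mono b c (ℕ.s≤s⁻¹ i<3+2s)) bound<v)
          (least (term b c i) ((i , refl) , λ res →
            p∤ (subst (λ z → + p ∣ z ^ suc N - z) (ℤ.+-comm (+ b * + i) c) (residue-fixed p p-prime {k} {N} {term b c i} p≡ res))))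
    where
    -- Here k ≥ 2, so 2 N ≤ k N = p - 1.
    2N<p : N ℕ.+ N < p
    2N<p = subst (N ℕ.+ N <_) (sym p≡) (s≤s (subst (N ℕ.+ N ≤_) (ℕ.*-comm k N) (ℕ.+-monoʳ-≤ N (ℕ.m≤m+n N (k-2 ℕ.* N)))))

-- Comparison of the integer bound with the real one, through upper cuts.

module RealBound where

  open import Defs as ℝ using (fromℤ; fromℕ; _÷_; √_)
  open ℝ.ℝ
  open import Data.Rational.Base as ℚ using (ℚ; 0ℚ; 1ℚ; _+_; _*_; _≤_; _<_; _/_; toℚᵘ)
  import Data.Rational.Properties as ℚ
  import Data.Rational.Unnormalised.Base as ℚᵘ
  import Data.Rational.Unnormalised.Properties as ℚᵘ

  ι : ℤ → ℚ
  ι z = z / 1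

  -- Since `_/_` reduces by a gcd, facts about `ι` are computed on unnormalised fractions and
  -- carried back.
  toℚᵘ-/ : ∀ z n .{{_ : NonZero n}} → toℚᵘ (z / n) ℚᵘ.≃ z ℚᵘ./ n
  toℚᵘ-/ z (suc n) = ℚ.toℚᵘ-fromℚᵘ (ℚᵘ.mkℚᵘ z n)

  ι-mono-≤ : ∀ {x y} → x ℤ.≤ y → ι x ≤ ι y
  ι-mono-≤ {x} {y} x≤y = ℚ.toℚᵘ-cancel-≤ (begin
    toℚᵘ (ι x)  ≃⟨ toℚᵘ-/ x 1 ⟩
    x ℚᵘ./ 1    ≤⟨ ℚᵘ.*≤* (ℤ.*-monoʳ-≤-nonNeg (+ 1) x≤y) ⟩
    y ℚᵘ./ 1    ≃⟨ toℚᵘ-/ y 1 ⟨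
    toℚᵘ (ι y)  ∎)
    where open ℚᵘ.≤-Reasoning

  ι-+ : ∀ x y → ι (x ℤ.+ y) ≡ ι x + ι y
  ι-+ x y = ℚ.toℚᵘ-injective (begin-equality
    toℚᵘ (ι (x ℤ.+ y))             ≃⟨ toℚᵘ-/ (x ℤ.+ y) 1 ⟩
    (x ℤ.+ y) ℚᵘ./ 1               ≃⟨ ℚᵘ.*≡* (cong (ℤ._* + 1) (sym (cong₂ ℤ._+_ (ℤ.*-identityʳ x) (ℤ.*-identityʳ y)))) ⟩
    x ℚᵘ./ 1 ℚᵘ.+ y ℚᵘ./ 1         ≃⟨ ℚᵘ.+-cong (toℚᵘ-/ x 1) (toℚᵘ-/ y 1) ⟨
    toℚᵘ (ι x) ℚᵘ.+ toℚᵘ (ι y)     ≃⟨ ℚ.toℚᵘ-homo-+ (ι x) (ι y) ⟨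
    toℚᵘ (ι x + ι y)               ∎)
    where open ℚᵘ.≤-Reasoning

  ι-* : ∀ x y → ι (x ℤ.* y) ≡ ι x * ι y
  ι-* x y = ℚ.toℚᵘ-injective (begin-equality
    toℚᵘ (ι (x ℤ.* y))             ≃⟨ toℚᵘ-/ (x ℤ.* y) 1 ⟩
    (x ℤ.* y) ℚᵘ./ 1               ≃⟨ ℚᵘ.*≡* refl ⟩
    (x ℚᵘ./ 1) ℚᵘ.* (y ℚᵘ./ 1)         ≃⟨ ℚᵘ.*-cong (toℚᵘ-/ x 1) (toℚᵘ-/ y 1) ⟨
    toℚᵘ (ι x) ℚᵘ.* toℚᵘ (ι y)     ≃⟨ ℚ.toℚᵘ-homo-* (ι x) (ι y) ⟨
    toℚᵘ (ι x * ι y)               ∎)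
    where open ℚᵘ.≤-Reasoning

  multiple-/ : ∀ N k .{{_ : NonZero k}} → + (N ℕ.* k) / k ≡ ι (+ N)
  multiple-/ N k@(suc _) = ℚ.fromℚᵘ-cong {ℚᵘ.mkℚᵘ (+ (N ℕ.* k)) _} {ℚᵘ.mkℚᵘ (+ N) 0}
    (ℚᵘ.*≡* (trans (ℤ.*-identityʳ _) (ℤ.pos-* N k)))

  0≤ι : ∀ n → 0ℚ ≤ ι (+ n)
  0≤ι n = ι-mono-≤ {+ 0} {+ n} (ℤ.+≤+ ℕ.z≤n)

  *-mono-≤ : ∀ {a b c d} → 0ℚ ≤ b → a ≤ b → 0ℚ ≤ c → c ≤ d → a * c ≤ b * d
  *-mono-≤ {a} {b} {c} {d} 0≤b a≤b 0≤c c≤d =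
    ℚ.≤-trans (ℚ.*-monoʳ-≤-nonNeg c {{ℚ.nonNegative 0≤c}} a≤b) (ℚ.*-monoˡ-≤-nonNeg b {{ℚ.nonNegative 0≤b}} c≤d)

  *-upper : ∀ {x y q} → upper (x ℝ.* y) q → ∃[ s ] ∃[ t ] upper x s × upper y t × s * t < q
  *-upper (s , s′ , t , t′ , _ , x<s′ , _ , y<t′ , max<q) =
    s′ , t′ , x<s′ , y<t′ , ℚ.≤-<-trans (ℚ.p≤q⊔p (s * t ℚ.⊔ s * t′ ℚ.⊔ s′ * t) (s′ * t′)) max<q

  square-<⇒< : ∀ {a b} → 0ℚ ≤ b → a * a < b * b → a < b
  square-<⇒< {a} {b} 0≤b a²<b² with a ℚ.<? b
  ... | yes a<b = a<b
  ... | no  a≮b = contradiction (ℚ.≤-<-trans (*-mono-≤ (ℚ.≤-trans 0≤b b≤a) b≤a 0≤b b≤a) a²<b²) (ℚ.<-irrefl refl)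
    where b≤a = ℚ.≮⇒≥ a≮b

  -- √5 < 3, so 7 / √5 > 7 / 3 > 2.
  2≤7÷√5 : ∀ {q} → upper (fromℕ 7 ÷ √ fromℕ 5) q → ι (+ 2) ≤ q
  2≤7÷√5 {q} u with *-upper {fromℕ 7} {(√ fromℕ 5) ℝ.⁻¹} u
  ... | s , w , 7<s , (r , 0<r , r<√5 , 1<wr) , sw<q = begin
    ι (+ 2) * 1ℚ          ≤⟨ ℚ.*-monoˡ-≤-nonNeg (ι (+ 2)) (ℚ.<⇒≤ 1<wr) ⟩
    ι (+ 2) * (w * r)     ≤⟨ ℚ.*-monoˡ-≤-nonNeg (ι (+ 2)) (ℚ.*-monoˡ-≤-nonNeg w {{ℚ.nonNegative 0≤w}} (ℚ.<⇒≤ (r<3 r<√5))) ⟩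
    ι (+ 2) * (w * ι (+ 3)) ≡⟨ cong (ι (+ 2) *_) (ℚ.*-comm w (ι (+ 3))) ⟩
    ι (+ 2) * (ι (+ 3) * w) ≡⟨ ℚ.*-assoc (ι (+ 2)) (ι (+ 3)) w ⟨
    ι (+ 6) * w           ≤⟨ *-mono-≤ (ℚ.≤-trans (0≤ι 7) (ℚ.<⇒≤ 7<s)) (ℚ.≤-trans (ι-mono-≤ {+ 6} {+ 7} (ℤ.+≤+ (ℕ.n≤1+n 6))) (ℚ.<⇒≤ 7<s)) 0≤w ℚ.≤-refl ⟩
    s * w                 ≤⟨ ℚ.<⇒≤ sw<q ⟩
    q                     ∎
    where
    open ℚ.≤-Reasoning
    r<3 : lower (√ fromℕ 5) r → r < ι (+ 3)
    r<3 (inj₁ r<0)  = contradiction (ℚ.<-trans r<0 0<r) (ℚ.<-irrefl refl)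
    r<3 (inj₂ r²<5) = square-<⇒< (0≤ι 3) (ℚ.<-≤-trans r²<5 (ι-mono-≤ {+ 5} {+ 9} (ℤ.+≤+ (ℕ.m≤m+n 5 4))))
    0≤w : 0ℚ ≤ w
    0≤w = ℚ.<⇒≤ (ℚ.*-cancelʳ-<-nonNeg r {{ℚ.nonNegative (ℚ.<⇒≤ 0<r)}}
      (ℚ.≤-<-trans (ℚ.≤-reflexive (ℚ.*-zeroˡ r)) (ℚ.<-trans (from-yes (0ℚ ℚ.<? 1ℚ)) 1<wr)))

  √-upper : ∀ {s N q} → s ℕ.* s ℕ.≤ N → upper (√ fromℕ N) q → ι (+ s) ≤ q
  √-upper {s} {N} s²≤N (0<q , N<q²) = ℚ.<⇒≤ (square-<⇒< (ℚ.<⇒≤ 0<q) (ℚ.≤-<-trans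
    (subst (_≤ ι (+ N)) (trans (cong ι (ℤ.pos-* s s)) (ι-* (+ s) (+ s))) (ι-mono-≤ (ℤ.+≤+ s²≤N))) N<q²))

  -- Bounding 7 / √5 below by 2 and √N by s reduces the claim to b (2 s + 2) ≤ 2 b s + 4 b, which
  -- holds with 2 b to spare.
  integer-bound-≤ : ∀ b c s N → s ℕ.* s ℕ.≤ N →
    fromℤ (+ b ℤ.* + (2 ℕ.+ (s ℕ.+ s)) ℤ.+ c) ℝ.≤
      fromℕ 7 ÷ √ fromℕ 5 ℝ.* fromℕ b ℝ.* √ fromℕ N ℝ.+ fromℕ 4 ℝ.* fromℕ b ℝ.+ fromℤ c
  integer-bound-≤ b c s N s²≤N q (_ , s₃ , (s₁ , s₂ , u₁ , u₂ , refl) , c<s₃ , refl) = begin-strict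
    ι (+ b ℤ.* + (2 ℕ.+ (s ℕ.+ s)) ℤ.+ c)              ≤⟨ ι-mono-≤ (ℤ.+-monoˡ-≤ c integer) ⟩
    ι (+ 2 ℤ.* + b ℤ.* + s ℤ.+ + 4 ℤ.* + b ℤ.+ c)      ≡⟨ ι-+ (+ 2 ℤ.* + b ℤ.* + s ℤ.+ + 4 ℤ.* + b) c ⟩
    ι (+ 2 ℤ.* + b ℤ.* + s ℤ.+ + 4 ℤ.* + b) + ι c      ≡⟨ cong (_+ ι c) (ι-+ (+ 2 ℤ.* + b ℤ.* + s) (+ 4 ℤ.* + b)) ⟩
    -- Strictness comes from the summand c alone.
    ι (+ 2 ℤ.* + b ℤ.* + s) + ι (+ 4 ℤ.* + b) + ι c    <⟨ ℚ.+-mono-≤-< (ℚ.+-mono-≤ first second) c<s₃ ⟩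
    s₁ + s₂ + s₃                                       ∎
    where
    open ℚ.≤-Reasoning
    integer : + b ℤ.* + (2 ℕ.+ (s ℕ.+ s)) ℤ.≤ + 2 ℤ.* + b ℤ.* + s ℤ.+ + 4 ℤ.* + b
    integer = subst (+ b ℤ.* + (2 ℕ.+ (s ℕ.+ s)) ℤ.≤_)
      (trans (cong (λ t → + b ℤ.* + (2 ℕ.+ (s ℕ.+ s)) ℤ.+ t) (ℤ.pos-* 2 b)) (regroup (+ b) (+ s)))
      (ℤ.i≤i+j _ (+ (2 ℕ.* b)))
      where
      regroup : ∀ b s → b ℤ.* (+ 2 ℤ.+ (s ℤ.+ s)) ℤ.+ + 2 ℤ.* b ≡ + 2 ℤ.* b ℤ.* s ℤ.+ + 4 ℤ.* b
      regroup = solve-∀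
    second : ι (+ 4 ℤ.* + b) ≤ s₂
    second with *-upper {fromℕ 4} {fromℕ b} u₂
    ... | t , t′ , 4<t , b<t′ , tt′<s₂ = begin
      ι (+ 4 ℤ.* + b)      ≡⟨ ι-* (+ 4) (+ b) ⟩
      ι (+ 4) * ι (+ b)    ≤⟨ *-mono-≤ (ℚ.≤-trans (0≤ι 4) (ℚ.<⇒≤ 4<t)) (ℚ.<⇒≤ 4<t) (0≤ι b) (ℚ.<⇒≤ b<t′) ⟩
      t * t′               ≤⟨ ℚ.<⇒≤ tt′<s₂ ⟩
      s₂                   ∎
    first : ι (+ 2 ℤ.* + b ℤ.* + s) ≤ s₁
    first with *-upper {fromℕ 7 ÷ √ fromℕ 5 ℝ.* fromℕ b} {√ fromℕ N} u₁
    ... | t , t′ , u , √N<t′ , tt′<s₁ with *-upper {fromℕ 7 ÷ √ fromℕ 5} {fromℕ b} u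
    ... | w , w′ , u′ , b<w′ , ww′<t = begin
      ι (+ 2 ℤ.* + b ℤ.* + s)      ≡⟨ ι-* (+ 2 ℤ.* + b) (+ s) ⟩
      ι (+ 2 ℤ.* + b) * ι (+ s)    ≤⟨ *-mono-≤ 0≤t 2b≤t (0≤ι s) (√-upper {s} {N} s²≤N √N<t′) ⟩
      t * t′                       ≤⟨ ℚ.<⇒≤ tt′<s₁ ⟩
      s₁                           ∎
      where
      2≤w = 2≤7÷√5 u′
      2b≤t : ι (+ 2 ℤ.* + b) ≤ t
      2b≤t = begin
        ι (+ 2 ℤ.* + b)      ≡⟨ ι-* (+ 2) (+ b) ⟩
        ι (+ 2) * ι (+ b)    ≤⟨ *-mono-≤ (ℚ.≤-trans (0≤ι 2) 2≤w) 2≤w (0≤ι b) (ℚ.<⇒≤ b<w′) ⟩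
        w * w′               ≤⟨ ℚ.<⇒≤ ww′<t ⟩
        t                    ∎
      0≤t : 0ℚ ≤ t
      0≤t = ℚ.≤-trans (subst (λ z → 0ℚ ≤ ι z) (ℤ.pos-* 2 b) (0≤ι (2 ℕ.* b))) 2b≤t

-- The bound of the theorem, with s = ⌊√N⌋.

open Residues using (floor-√; least-nonresidue-≤)
open RealBound using (ι-mono-≤; multiple-/; integer-bound-≤)
open import Defs
open import Data.Nat.Divisibility using (_∣_; divides)
open import Data.Rational.Base using (_/_)
import Data.Rational.Properties as ℚ

theorem1p1 : (p k : ℕ) .{{_ : NonZero p}} .{{_ : NonZero k}} → Prime p → k ∣ p ∸ 1 →
    (b : ℕ) (c : ℤ) (v : ℤ) → IsLeast (NonResidueTerm p k b c) v →
    fromℤ v ≤ fromℕ 7 ÷ √ fromℕ 5 * fromℕ b * √ fromℚ (+ (p ∸ 1) / k) + fromℕ 4 * fromℕ b + fromℤ c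
theorem1p1 p k p-prime (divides N p-1≡N*k) b c v least q bound<q with floor-√ N
... | s , s²≤N , N<[1+s]² = ℚ.≤-<-trans
  (ι-mono-≤ {v} (least-nonresidue-≤ p p-prime k N p≡ s s²≤N N<[1+s]² b c v least))
  (integer-bound-≤ b c s N s²≤N q
    -- The rational (p - 1) / k under the root is the integer N.
    (subst (λ r → ℝ.upper (fromℕ 7 ÷ √ fromℕ 5 * fromℕ b * √ fromℚ r + fromℕ 4 * fromℕ b + fromℤ c) q)
      (trans (cong (λ n → + n / k) p-1≡N*k) (multiple-/ N k)) bound<q))
  where
  p≡ : p ≡ suc (N ℕ.* k)
  p≡ = trans (sym (ℕ.m+[n∸m]≡n (ℕ.>-nonZero⁻¹ p))) (cong suc p-1≡N*k)
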